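{- Let $\Gamma\vdash M:o$ and $\Gamma\vdash M':o$ be $\eta$-long locally scoped terms, and let $\sigma$ be an $\eta$-long, locally scoped, flat environment on $\Gamma$ such that $M\to_\sigma M'$. Then there is a skeleton $a$ such that $$[\![M]\!]_{[\![\sigma]\!]}\leadsto a\quad\text{and}\quad[\![M']\!]_{[\![\sigma]\!]}\hookrightarrow a.$$ So in particular, if $M\to_{\mathrm{lhr}}M'$, then there is a skeleton $a$ with $[\![M]\!]\leadsto a$ and $[\![M']\!]\hookrightarrow a$.
   Context: **Terms.** Types are $A,B::=o\mid A\to B$. Terms are those of the simply-typed $\lambda$-calculus à la Church: $M,N::=\lambda x^A.M\mid M\,N\mid x\mid *_A$, with one constant $*_A:A$ for each type $A$ (often written $*$). Contexts $\Gamma$ are sets of pairs $x:A$ of a variable and a type. All terms are well-typed, considered up to $\alpha$-equivalence, and assumed to obey Barendregt's convention. $\mathrm{lv}(o)=0$, $\mathrm{lv}(A\to B)=\max(\mathrm{lv}(A)+1,\mathrm{lv}(B))$; $\mathrm{lv}(x)$ is the level of the type of $x$. **Redexes, linear head reduction.** Prime redexes of a term are pairs $(\lambda x,N)$, defined by induction on length: $*\,M_1\dots M_n$ and $x\,M_1\dots M_n$ have none; those of $\lambda x.M'$ are those of $M'$; those of $(\lambda x.M')M_1\dots M_n$ ($n\geq1$) are $(\lambda x,M_1)$ plus those of $M'M_2\dots M_n$. Generalized redexes of $M$ are the prime redexes of all subterms of $M$. The head occurrence of $M$ is its leftmost occurrence of a variable or constant. If it is an occurrence $x_0$ of a variable $x$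 and $(\lambda x,N)$ is a prime redex of $M$, then $M\to_{\mathrm{lhr}}M[N/x_0]$ (only the occurrence $x_0$ is replaced). **$\eta$-long, locally scoped.** $\to_\eta$ is the context closure of $M\to_\eta\lambda x^A.M\,x$ (for $M:A\to B$ and $x$ not free in $M$). $M$ is $\eta$-long if whenever $M\to_\eta M'$, $M'$ has more generalized redexes than $M$. A variable $x$ in $M$ is active if it is free in $M$ or there is a generalized redex $(\lambda x,N)$ in $M$; $M$ is locally scoped if for every generalized redex $(\lambda x,N)$ in $M$ all free variables of $N$ are active in $M$. **Environments.** By mutual induction: a closure is a pair of a term $\Gamma\vdash N:A$ and an environment on $\Gamma$; an environment $\sigma$ on $\Gamma$ is a partial function which, when defined, maps a variable $(x:A)$ of $\Gamma$ to a closure $(\Gamma\vdash N:A,\tau)$, and one writes $\sigma_1(x)=N$, $\sigma_2(x)=\tau$. A closure $(\Gamma\vdash M:A,\sigma)$ is written $M^\sigma$. $\sigma$ is flat if $\sigma_2(x)\subseteq\sigma$ for each $(x:A)\in\Gamma$ on which $\sigma$ is defined. $\sigma$ is $\eta$-long (resp. locally scoped) if whenever $\sigma(x)$ is defined, both the term $\sigma_1(x)$ and (recursively) the environment $\sigma_2(x)$ are $\eta$-long (resp. locally scoped). **Reduction $\to_\sigma$.** Generated by: $x\,M_1\dots M_n\to_\sigma\sigma_1(x)\,M_1\dots M_n$ (where $\sigma(x)$ is defined); if $M\to_\sigma M'$ then $\lambda y.M\to_\sigma\lambda y.M'$; if $M'M_2\dots M_n\to_{\sigma\cup\{y\mapsto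 M_1^\sigma\}}M''M_2\dots M_n$ then $(\lambda y.M')M_1\dots M_n\to_\sigma(\lambda y.M'')M_1\dots M_n$. **Skeletons.** A skeleton is a finite tree with nodes and edges labeled by natural numbers; $n[\{d_1\}a_1,\dots,\{d_p\}a_p]$ has root label $n$ and subtrees $a_k$ along edges labeled $d_k$; $n$ denotes $n[\,]$. $a\cdot_db$ is $a$ with an extra child $b$ attached to its root by an edge labeled $d$. Reduction (only at the root): $n[\{d_1\}a_1,\dots,\{d_p\}a_p]\leadsto a_i\cdot_{d_i-1}(n-1)[\{d_1\}a_1,\dots,\{d_p\}a_p]$ when $n,d_i\geq1$. Embedding: $n[\{d_1\}a_1,\dots,\{d_p\}a_p]\hookrightarrow n'[\{d'_1\}a'_1,\dots,\{d'_{p'}\}a'_{p'}]$ iff $n\leq n'$ and for every $i$ there is $j$ with $d_i\leq d'_j$ and $a_i\hookrightarrow a'_j$. $\bigsqcup_{i=1}^na_i$ has as root label the maximum of the root labels of the $a_i$, and as children all the children of all the $a_i$ (with their edge labels); the empty $\bigsqcup$ is $0$. $1+a$ is $a$ with its root label increased by $1$. **Interpretation.** A bs-environment $\rho$ is a partial function from variables of the context to skeletons. By induction on length: $[\![*\,M_1\dots M_n]\!]_\rho=0$; $[\![x\,M_1\dots M_n]\!]_\rho=1+\bigsqcup_i[\![M_i]\!]_\rho$ if $\rho(x)$ is undefined; $[\![x\,M_1\dots M_n]\!]_\rho=(1+\bigsqcup_i[\![M_i]\!]_\rho)\cdot_{\mathrm{lv}(x)+1}\rho(x)$ if $\rho(x)$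 is defined; $[\![\lambda x.M]\!]_\rho=[\![M]\!]_\rho$; $[\![(\lambda x.M)M_1\dots M_n]\!]_\rho=[\![M\,M_2\dots M_n]\!]_{\rho\cup\{x\mapsto[\![M_1]\!]_\rho\}}$. $[\![M]\!]$ denotes $[\![M]\!]_\emptyset$. For an environment $\sigma$ on $\Gamma$, $[\![\sigma]\!]$ is the bs-environment which is undefined on $x$ if $\sigma(x)$ is undefined, and has $[\![\sigma]\!](x)=[\![\sigma_1(x)]\!]_{[\![\sigma_2(x)]\!]}$ otherwise.
   Formalization: The first part also assumes that if σ(x)=N^τ and a free variable y of N is undefined in τ, then σ(y) is undefined; without it the claim fails for σ={x↦z^∅, z↦*^∅}, M=x, M'=z with x,z:o. -}

module Defs where

open import Data.List.Base using (List; []; _∷_; _++_; map; length; foldr; concatMap; deduplicate; [_])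
open import Data.List.Membership.Propositional using (_∈_)
open import Data.List.Properties using (≡-dec)
open import Data.List.Relation.Binary.Subset.Propositional using (_⊆_)
open import Data.List.Relation.Unary.All using (All; []; _∷_; lookup; universal)
open import Data.List.Relation.Unary.Any using (Any; here; there)
open import Data.Maybe.Base using (Maybe; just; nothing)
open import Data.Nat.Base using (ℕ; zero; suc; _⊔_; _≤_; _<_)
import Data.Nat.Properties as ℕ
open import Data.Product.Base using (_×_; _,_)
open import Data.Product.Properties using () renaming (≡-dec to ×-≡-dec)
open import Relation.Binary.PropositionalEquality using (_≡_; refl)

------------------------------------------------------------------------
-- Terms: intrinsically typed de Bruijn terms, i.e. typed terms up to
-- α-equivalence.

infixr 7 _⇒_
infix  8 _∈FV_
infixl 9 _·_ _·*_

data Ty : Set where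
  o   : Ty
  _⇒_ : Ty → Ty → Ty

lv : Ty → ℕ
lv o       = 0
lv (A ⇒ B) = suc (lv A) ⊔ lv B

Ctx : Set
Ctx = List Ty

data Term (Γ : Ctx) : Ty → Set where
  con : ∀ {A} → Term Γ A
  var : ∀ {A} → A ∈ Γ → Term Γ A
  ƛ   : ∀ {A B} → Term (A ∷ Γ) B → Term Γ (A ⇒ B)
  _·_ : ∀ {A B} → Term Γ (A ⇒ B) → Term Γ A → Term Γ B

lift : ∀ {Γ Δ : Ctx} {A} → Γ ⊆ Δ → (A ∷ Γ) ⊆ (A ∷ Δ)
lift ι (here p)  = here p
lift ι (there x) = there (ι x)

rename : ∀ {Γ Δ A} → Γ ⊆ Δ → Term Γ A → Term Δ A
rename ι con     = con
rename ι (var x) = var (ι x)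
rename ι (ƛ M)   = ƛ (rename (lift ι) M)
rename ι (M · N) = rename ι M · rename ι N

wk : ∀ {Γ A B} → Term Γ A → Term (B ∷ Γ) A
wk = rename there

data _∈FV_ {Γ A} (x : A ∈ Γ) : ∀ {B} → Term Γ B → Set where
  var  : x ∈FV var x
  lam  : ∀ {B C} {M : Term (B ∷ Γ) C} → there x ∈FV M → x ∈FV ƛ M
  appˡ : ∀ {B C} {M : Term Γ (B ⇒ C)} {N : Term Γ B} → x ∈FV M → x ∈FV (M · N)
  appʳ : ∀ {B C} {M : Term Γ (B ⇒ C)} {N : Term Γ B} → x ∈FV N → x ∈FV (M · N)

-- Args Γ A B: the arguments M₁ … Mₙ in the application M M₁ … Mₙ : B of
-- some M : A.

data Args (Γ : Ctx) : Ty → Ty → Set where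
  []  : ∀ {A} → Args Γ A A
  _∷_ : ∀ {A B C} → Term Γ A → Args Γ B C → Args Γ (A ⇒ B) C

_·*_ : ∀ {Γ A B} → Term Γ A → Args Γ A B → Term Γ B
M ·* []       = M
M ·* (N ∷ Ns) = (M · N) ·* Ns

wkArgs : ∀ {Γ A B C} → Args Γ A B → Args (C ∷ Γ) A B
wkArgs []       = []
wkArgs (N ∷ Ns) = wk N ∷ wkArgs Ns

------------------------------------------------------------------------
-- Subterm occurrences and variable names

-- Occ R N: an occurrence of N as a subterm of R, built from the root of
-- R downwards.

data Occ {Γ A} (R : Term Γ A) : ∀ {Δ B} → Term Δ B → Set where
  root : Occ R R
  body : ∀ {Δ B C} {M : Term (B ∷ Δ) C} → Occ R (ƛ M) → Occ R M
  fun  : ∀ {Δ B C} {M : Term Δ (B ⇒ C)} {N : Term Δ B} → Occ R (M · N) → Occ R M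
  arg  : ∀ {Δ B C} {M : Term Δ (B ⇒ C)} {N : Term Δ B} → Occ R (M · N) → Occ R N

-- The address of the node in the syntax tree, deepest step first.

address : ∀ {Γ A} {R : Term Γ A} {Δ B} {N : Term Δ B} → Occ R N → List ℕ
address root     = []
address (body p) = 0 ∷ address p
address (fun p)  = 0 ∷ address p
address (arg p)  = 1 ∷ address p

-- The variables of R, free or bound. A bound variable is named after the
-- occurrence of its binder, so that distinct binders bind distinct
-- variables, as in Barendregt's convention.

data Var {Γ A} (R : Term Γ A) : Ty → Set where
  free  : ∀ {B} → B ∈ Γ → Var R B
  bound : ∀ {Δ B C} {P : Term (B ∷ Δ) C} → Occ R (ƛ P) → Var R B

-- The variable of R that an index in scope at an occurrence stands for.

name : ∀ {Γ A} {R : Term Γ A} {Δ B} {N : Term Δ B} →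
       Occ R N → ∀ {C} → C ∈ Δ → Var R C
name root     x           = free x
name (body p) (here refl) = bound p
name (body p) (there x)   = name p x
name (fun p)  x           = name p x
name (arg p)  x           = name p x

replace : ∀ {Γ A} {R : Term Γ A} {Δ B} {N : Term Δ B} →
          Occ R N → Term Δ B → Term Γ A
replace root                L = L
replace (body p)            L = replace p (ƛ L)
replace (fun {N = N} p)     L = replace p (L · N)
replace (arg {M = M} p)     L = replace p (M · L)

------------------------------------------------------------------------
-- Prime and generalized redexes

-- A redex (λx, N) of R: the binder λx and the subterm N are given by
-- their occurrences in R.

record Redex {Γ A} (R : Term Γ A) : Set where
  constructor redex
  field
    {Δ Θ}    : Ctx
    {B C}    : Ty
    {P}      : Term (B ∷ Δ) C
    {N}      : Term Θ B
    binder   : Occ R (ƛ P)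
    argument : Occ R N

data Stack {Γ A} (R : Term Γ A) : Ty → Ty → Set where
  []  : ∀ {B} → Stack R B B
  _∷_ : ∀ {Δ B C D} {N : Term Δ B} → Occ R N → Stack R C D → Stack R (B ⇒ C) D

-- primeAt p S: the prime redexes of M M₁ … Mₙ, where M occurs in R at p
-- and the Mᵢ occur in R at the entries of S.

primeAt : ∀ {Γ A} {R : Term Γ A} {Δ B C} {M : Term Δ B} →
          Occ R M → Stack R B C → List (Redex R)
primeAt {M = con}   p S       = []
primeAt {M = var x} p S       = []
primeAt {M = ƛ M}   p []      = primeAt (body p) []
primeAt {M = ƛ M}   p (n ∷ S) = redex p n ∷ primeAt (body p) S
primeAt {M = M · N} p S       = primeAt (fun p) (arg p ∷ S)

primeRedexes : ∀ {Γ A} (M : Term Γ A) → List (Redex M)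
primeRedexes M = primeAt {R = M} root []

-- The prime redexes of all subterms of the subterm at p.

redexesBelow : ∀ {Γ A} {R : Term Γ A} {Δ B} {M : Term Δ B} → Occ R M → List (Redex R)
redexesBelow {M = con}   p = primeAt p []
redexesBelow {M = var x} p = primeAt p []
redexesBelow {M = ƛ M}   p = primeAt p [] ++ redexesBelow (body p)
redexesBelow {M = M · N} p = primeAt p [] ++ redexesBelow (fun p) ++ redexesBelow (arg p)

-- A generalized redex is listed once for each subterm of which it is a
-- prime redex; #redexes counts it only once.

genRedexes : ∀ {Γ A} (M : Term Γ A) → List (Redex M)
genRedexes M = redexesBelow {R = M} root

addresses : ∀ {Γ A} {R : Term Γ A} → Redex R → List ℕ × List ℕ
addresses (redex b n) = address b , address n

#redexes : ∀ {Γ A} → Term Γ A → ℕ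
#redexes M = length (deduplicate (×-≡-dec (≡-dec ℕ._≟_) (≡-dec ℕ._≟_))
                                 (map addresses (genRedexes M)))

------------------------------------------------------------------------
-- Linear head reduction

data Leftmost {Γ A} {R : Term Γ A} : ∀ {Δ B} {N : Term Δ B} → Occ R N → Set where
  root : Leftmost root
  body : ∀ {Δ B C} {M : Term (B ∷ Δ) C} {p : Occ R (ƛ M)} → Leftmost p → Leftmost (body p)
  fun  : ∀ {Δ B C} {M : Term Δ (B ⇒ C)} {N : Term Δ B} {p : Occ R (M · N)} →
         Leftmost p → Leftmost (fun p)

-- The copy of N put at x₀ has the same (named) variables as N; ι is the
-- reindexing this requires.

data _→lhr_ {Γ A} (M : Term Γ A) : Term Γ A → Set where
  lhr : ∀ {Δ Θ Ξ B C} {P : Term (B ∷ Ξ) C} {N : Term Θ B} {x : B ∈ Δ}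
        (x₀ : Occ M (var x)) (λx : Occ M (ƛ P)) (n : Occ M N) →
        Leftmost x₀ →
        redex λx n ∈ primeRedexes M →
        name x₀ x ≡ bound λx →
        (ι : Θ ⊆ Δ) → (∀ {D} (y : D ∈ Θ) → name x₀ (ι y) ≡ name n y) →
        M →lhr replace x₀ (rename ι N)

------------------------------------------------------------------------
-- η-long and locally scoped terms

data _→η_ {Γ} : ∀ {A} → Term Γ A → Term Γ A → Set where
  exp  : ∀ {A B} {M : Term Γ (A ⇒ B)} → M →η ƛ (wk M · var (here refl))
  lam  : ∀ {A B} {M M′ : Term (A ∷ Γ) B} → M →η M′ → ƛ M →η ƛ M′
  appˡ : ∀ {A B} {M M′ : Term Γ (A ⇒ B)} {N : Term Γ A} → M →η M′ → (M · N) →η (M′ · N)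
  appʳ : ∀ {A B} {M : Term Γ (A ⇒ B)} {N N′ : Term Γ A} → N →η N′ → (M · N) →η (M · N′)

ηLong : ∀ {Γ A} → Term Γ A → Set
ηLong M = ∀ {M′} → M →η M′ → #redexes M < #redexes M′

data Active {Γ A} (M : Term Γ A) : ∀ {B} → Var M B → Set where
  free  : ∀ {B} {x : B ∈ Γ} → x ∈FV M → Active M (free x)
  redex : ∀ {r : Redex M} → r ∈ genRedexes M → Active M (bound (Redex.binder r))

LocallyScoped : ∀ {Γ A} → Term Γ A → Set
LocallyScoped M =
  ∀ {r : Redex M} → r ∈ genRedexes M →
  ∀ {B} (x : B ∈ Redex.Θ r) → x ∈FV Redex.N r → Active M (name (Redex.argument r) x)

------------------------------------------------------------------------
-- Environments

-- A partial function on Γ is a list of optional values indexed by Γ. It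
-- stays first-order, so that equality of closures is _≡_.

data Closure (Γ : Ctx) (A : Ty) : Set where
  ⟨_,_⟩ : Term Γ A → All (λ B → Maybe (Closure Γ B)) Γ → Closure Γ A

Env : Ctx → Set
Env Γ = All (λ A → Maybe (Closure Γ A)) Γ

wkClosure : ∀ {Γ A B} → Closure Γ A → Closure (B ∷ Γ) A
wkClosures : ∀ {Γ Δ B} → All (λ A → Maybe (Closure Γ A)) Δ →
             All (λ A → Maybe (Closure (B ∷ Γ) A)) Δ
wkClosure ⟨ N , τ ⟩ = ⟨ wk N , nothing ∷ wkClosures τ ⟩
wkClosures []            = []
wkClosures (nothing ∷ σ) = nothing ∷ wkClosures σ
wkClosures (just c ∷ σ)  = just (wkClosure c) ∷ wkClosures σ

-- σ on Γ, seen as an environment on Γ, y : B that is undefined on y.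

wkEnv : ∀ {Γ B} → Env Γ → Env (B ∷ Γ)
wkEnv σ = nothing ∷ wkClosures σ

-- σ ∪ {y ↦ N^σ}

_∪↦_ : ∀ {Γ B} → Env Γ → Term Γ B → Env (B ∷ Γ)
σ ∪↦ N = just (wkClosure ⟨ N , σ ⟩) ∷ wkClosures σ

_⊆ᴱ_ : ∀ {Γ} → Env Γ → Env Γ → Set
_⊆ᴱ_ {Γ} τ σ = ∀ {A} (x : A ∈ Γ) {c} → lookup τ x ≡ just c → lookup σ x ≡ just c

Flat : ∀ {Γ} → Env Γ → Set
Flat {Γ} σ = ∀ {A} (x : A ∈ Γ) {N τ} → lookup σ x ≡ just ⟨ N , τ ⟩ → τ ⊆ᴱ σ

-- If σ(x) = N^τ, then a free variable of N left undefined by τ is also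
-- undefined in σ: the inclusion τ ⊆ σ required by Flat binds no further
-- variable of N. The environments σ ∪ {y ↦ N^σ} built by _⟶[_]_ have this
-- property if σ does, but Flat does not imply it: it fails for
-- σ = {x ↦ z^∅, z ↦ *^∅} with x, z : o. There x ⟶[ σ ] z and, writing
-- n[{d}a] for node n [ (d , a) ] and n for node n [], ⟦x⟧ = 1[{1}1] has the
-- only reduct 1[{0}0[{1}1]], in which ⟦z⟧ = 1[{1}0] does not embed.

KeepsUndefined : ∀ {Γ} → Env Γ → Set
KeepsUndefined {Γ} σ =
  ∀ {A} (x : A ∈ Γ) {N τ} → lookup σ x ≡ just ⟨ N , τ ⟩ →
  ∀ {B} (y : B ∈ Γ) → y ∈FV N → lookup τ y ≡ nothing → lookup σ y ≡ nothing

data Hereditarily (P : ∀ {Γ A} → Term Γ A → Set) {Γ} (σ : Env Γ) : Set where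
  hereditarily :
    (∀ {A} (x : A ∈ Γ) {N τ} → lookup σ x ≡ just ⟨ N , τ ⟩ → P N × Hereditarily P τ) →
    Hereditarily P σ

ηLongᴱ : ∀ {Γ} → Env Γ → Set
ηLongᴱ = Hereditarily ηLong

LocallyScopedᴱ : ∀ {Γ} → Env Γ → Set
LocallyScopedᴱ = Hereditarily LocallyScoped

data _⟶[_]_ {Γ} : ∀ {A} → Term Γ A → Env Γ → Term Γ A → Set where
  head : ∀ {A B σ N τ} {x : A ∈ Γ} (Ms : Args Γ A B) →
         lookup σ x ≡ just ⟨ N , τ ⟩ →
         (var x ·* Ms) ⟶[ σ ] (N ·* Ms)
  abs  : ∀ {A B σ} {M M′ : Term (A ∷ Γ) B} →
         M ⟶[ wkEnv σ ] M′ →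
         ƛ M ⟶[ σ ] ƛ M′
  beta : ∀ {A B C σ} {M′ M″ : Term (A ∷ Γ) B} {M₁ : Term Γ A} (Ms : Args Γ B C) →
         (M′ ·* wkArgs Ms) ⟶[ σ ∪↦ M₁ ] (M″ ·* wkArgs Ms) →
         ((ƛ M′ · M₁) ·* Ms) ⟶[ σ ] ((ƛ M″ · M₁) ·* Ms)

------------------------------------------------------------------------
-- Skeletons

infixl 6 _·[_]_
infix  4 _⇝_ _↪_

data Skeleton : Set where
  node : ℕ → List (ℕ × Skeleton) → Skeleton

label : Skeleton → ℕ
label (node n as) = n

children : Skeleton → List (ℕ × Skeleton)
children (node n as) = as

_·[_]_ : Skeleton → ℕ → Skeleton → Skeleton
node n as ·[ d ] b = node n (as ++ [ (d , b) ])

data _⇝_ : Skeleton → Skeleton → Set where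
  step : ∀ {n d a as} → (suc d , a) ∈ as → node (suc n) as ⇝ a ·[ d ] node n as

data _↪_ : Skeleton → Skeleton → Set where
  embed : ∀ {n n′ as as′} → n ≤ n′ →
          All (λ (d , a) → Any (λ (d′ , a′) → d ≤ d′ × a ↪ a′) as′) as →
          node n as ↪ node n′ as′

⨆ : List Skeleton → Skeleton
⨆ as = node (foldr _⊔_ 0 (map label as)) (concatMap children as)

1+_ : Skeleton → Skeleton
1+ node n as = node (suc n) as

------------------------------------------------------------------------
-- Interpretation

BSEnv : Ctx → Set
BSEnv Γ = All (λ _ → Maybe Skeleton) Γ

-- ⟦ M ∣ S ⟧ ρ is the interpretation in ρ of M M₁ … Mₙ, with S the list of
-- the interpretations of the Mᵢ. These do not change when ρ is extended
-- under a binder λx of M, as x is not free in Mᵢ.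

⟦_∣_⟧ : ∀ {Γ A} → Term Γ A → List Skeleton → BSEnv Γ → Skeleton
⟦ con ∣ S ⟧ ρ = node 0 []
⟦ var {A} x ∣ S ⟧ ρ with lookup ρ x
... | nothing = 1+ ⨆ S
... | just a  = (1+ ⨆ S) ·[ suc (lv A) ] a
⟦ ƛ M ∣ [] ⟧ ρ = ⟦ M ∣ [] ⟧ (nothing ∷ ρ)
⟦ ƛ M ∣ a ∷ S ⟧ ρ = ⟦ M ∣ S ⟧ (just a ∷ ρ)
⟦ M · N ∣ S ⟧ ρ = ⟦ M ∣ ⟦ N ∣ [] ⟧ ρ ∷ S ⟧ ρ

⟦_⟧ : ∀ {Γ A} → Term Γ A → BSEnv Γ → Skeleton
⟦ M ⟧ = ⟦ M ∣ [] ⟧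

∅ᴮ : ∀ {Γ} → BSEnv Γ
∅ᴮ {Γ} = universal (λ _ → nothing) Γ

⟦_⟧ᴱ : ∀ {Γ Δ} → All (λ A → Maybe (Closure Γ A)) Δ → BSEnv Δ
⟦ [] ⟧ᴱ                   = []
⟦ nothing ∷ σ ⟧ᴱ          = nothing ∷ ⟦ σ ⟧ᴱ
⟦ just ⟨ N , τ ⟩ ∷ σ ⟧ᴱ   = just (⟦ N ⟧ ⟦ τ ⟧ᴱ) ∷ ⟦ σ ⟧ᴱ

{-# OPTIONS --safe #-}

-- Let x : A be replaced by N in x M₁ … Mₙ : o. As N is η-long, its first n
-- unapplied abstractions λx₁, …, λxₙ consume M₁, …, Mₙ, and lv xᵢ < lv A. As
-- N is locally scoped, no redex argument inside N mentions an xᵢ, so binding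
-- the xᵢ leaves everything stored deep in ⟦ N ⟧ unchanged: it only adds
-- children ⟦ Mᵢ ⟧ to the root, along edges labeled lv xᵢ + 1 ≤ lv A. These
-- embed into the child along the edge lv A that ⇝ adds to ⟦ N ⟧.
--
-- η-longness provides the abstractions because η-expanding a term of type
-- B ⇒ C that would not consume a further argument creates no redex.

module Submission where

open import Data.Empty using (⊥-elim)
open import Data.List.Base as List
  using (List; []; _∷_; _++_; _∷ʳ_; [_]; map; length; concatMap; deduplicate; drop)
open import Data.List.Membership.Propositional using (_∈_; lose)
open import Data.List.Membership.Propositional.Properties
  using (∈-++⁺ˡ; ∈-++⁺ʳ; ∈-++⁻; ∈-∃++; ∈-map⁺; ∈-map⁻; ∈-deduplicate⁺; ∈-deduplicate⁻)
open import Data.List.Properties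
  using (≡-dec; ++-assoc; ++-cancelʳ; ++-identityʳ; ++-identityˡ-unique; ∷ʳ-injectiveʳ;
         length-map; length-++; length-drop)
open import Data.List.Relation.Binary.Permutation.Propositional.Properties using (shift; ↭-length)
open import Data.List.Relation.Binary.Pointwise.Base using (Pointwise; []; _∷_)
open import Data.List.Relation.Binary.Subset.Propositional using (_⊆_)
open import Data.List.Relation.Unary.All as All using (All; []; _∷_; lookup)
import Data.List.Relation.Unary.All.Properties as All
open import Data.List.Relation.Unary.AllPairs as AllPairs using (AllPairs; []; _∷_)
import Data.List.Relation.Unary.AllPairs.Properties as AllPairs
open import Data.List.Relation.Unary.Any using (Any; here; there)
open import Data.List.Relation.Unary.Unique.DecPropositional.Properties using (deduplicate-!)
open import Data.List.Relation.Unary.Unique.Propositional using (Unique)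
open import Data.Maybe.Base using (Maybe; just; nothing)
open import Data.Nat.Base
  using (ℕ; zero; suc; pred; _+_; _≤_; _<_; _⊔_; z≤n; s≤s; z<s; s<s⁻¹)
import Data.Nat.Properties as ℕ
open import Data.Product using (_×_; _,_; proj₁; proj₂; ∃; ∃-syntax)
open import Data.Product.Properties using () renaming (≡-dec to ×-≡-dec)
open import Data.Sum using (_⊎_; inj₁; inj₂; [_,_]′)
open import Data.Unit using (⊤; tt)
open import Function.Base using (id)
open import Relation.Binary.PropositionalEquality
  using (_≡_; _≢_; refl; sym; trans; cong; cong₂; subst; subst₂; module ≡-Reasoning)
open import Relation.Nullary using (¬_)
open import Defs

-- Pigeonhole: as `x` does not recur in `xs`, deleting one occurrence of it from `ys` keeps the rest
-- of `xs` inside.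
length-⊆ : ∀ {X : Set} {xs ys : List X} → Unique xs → xs ⊆ ys → length xs ≤ length ys
length-⊆ [] _ = z≤n
length-⊆ {xs = x ∷ xs} {ys} (x∉ ∷ uniq) sub with ∈-∃++ (sub (here refl))
... | us , vs , refl = begin
  suc (length xs)         ≤⟨ s≤s (length-⊆ uniq avoid) ⟩
  suc (length (us ++ vs)) ≡⟨ ↭-length (shift x us vs) ⟨
  length (us ++ x ∷ vs)   ∎
  where
  open ℕ.≤-Reasoning
  avoid : xs ⊆ us ++ vs
  avoid y∈ with ∈-++⁻ us (sub (there y∈))
  ... | inj₁ y∈us         = ∈-++⁺ˡ y∈us
  ... | inj₂ (here refl)  = ⊥-elim (lookup x∉ y∈ refl)
  ... | inj₂ (there y∈vs) = ∈-++⁺ʳ us y∈vs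

private variable
  Γ Δ : Ctx
  A B C D : Ty
  k : ℕ

-- Counting generalized redexes

-- The number of redexes of M M₁ … Mₖ with binder in M.
count : Term Γ A → ℕ → ℕ
count con     k       = 0
count (var x) k       = 0
count (ƛ M)   zero    = count M 0
count (ƛ M)   (suc k) = suc (count M k)
count (M · N) k       = count M (suc k) + count N 0

count-rename : (ι : Γ ⊆ Δ) (M : Term Γ A) → count (rename ι M) k ≡ count M k
count-rename ι con = refl
count-rename ι (var x) = refl
count-rename {k = zero}  ι (ƛ M) = count-rename (lift ι) M
count-rename {k = suc k} ι (ƛ M) = cong suc (count-rename (lift ι) M)
count-rename ι (M · N) = cong₂ _+_ (count-rename ι M) (count-rename ι N)

stackLength : {R : Term Γ A} → Stack R B C → ℕ
stackLength []      = 0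
stackLength (n ∷ S) = suc (stackLength S)

binderAddress : {R : Term Γ A} → Redex R → List ℕ
binderAddress r = address (Redex.binder r)

module _ {R : Term Γ A} where

  -- Prefix order. Prime redexes of a subterm start from the empty stack, while `redexesAt` carries
  -- the arguments collected above it; a prefix pairs the same binders with the same arguments.
  data _≤ˢ_ : Stack R B C → Stack R B D → Set where
    []  : {S : Stack R B C} → [] ≤ˢ S
    _∷_ : ∀ {N : Term Δ B} (n : Occ R N) {S : Stack R C D} {D′} {T : Stack R C D′} →
          S ≤ˢ T → (n ∷ S) ≤ˢ (n ∷ T)

  -- The redexes of M M₁ … Mₙ with binder in M, without the repetitions of
  -- redexesBelow.
  redexesAt : {M : Term Δ B} → Occ R M → Stack R B C → List (Redex R)
  redexesAt {M = con}   p S       = []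
  redexesAt {M = var x} p S       = []
  redexesAt {M = ƛ M}   p []      = redexesAt (body p) []
  redexesAt {M = ƛ M}   p (n ∷ S) = redex p n ∷ redexesAt (body p) S
  redexesAt {M = M · N} p S       = redexesAt (fun p) (arg p ∷ S) ++ redexesAt (arg p) []

  length-redexesAt : {M : Term Δ B} (p : Occ R M) (S : Stack R B C) →
                     length (redexesAt p S) ≡ count M (stackLength S)
  length-redexesAt {M = con}   p S       = refl
  length-redexesAt {M = var x} p S       = refl
  length-redexesAt {M = ƛ M}   p []      = length-redexesAt (body p) []
  length-redexesAt {M = ƛ M}   p (n ∷ S) = cong suc (length-redexesAt (body p) S)
  length-redexesAt {M = M · N} p S       =
    trans (length-++ (redexesAt (fun p) (arg p ∷ S)))
          (cong₂ _+_ (length-redexesAt (fun p) (arg p ∷ S)) (length-redexesAt (arg p) []))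

  primeAt⊆redexesAt : {M : Term Δ B} (p : Occ R M) {S : Stack R B C} {T : Stack R B D} →
                      S ≤ˢ T → primeAt p S ⊆ redexesAt p T
  primeAt⊆redexesAt {M = ƛ M} p {T = []}    []        r∈ = primeAt⊆redexesAt (body p) [] r∈
  primeAt⊆redexesAt {M = ƛ M} p {T = n ∷ T} []        r∈ = there (primeAt⊆redexesAt (body p) [] r∈)
  primeAt⊆redexesAt {M = ƛ M} p (n ∷ S≤T) (here refl) = here refl
  primeAt⊆redexesAt {M = ƛ M} p (n ∷ S≤T) (there r∈)  = there (primeAt⊆redexesAt (body p) S≤T r∈)
  primeAt⊆redexesAt {M = M · N} p S≤T r∈ = ∈-++⁺ˡ (primeAt⊆redexesAt (fun p) (arg p ∷ S≤T) r∈)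

  redexesBelow⊆redexesAt : {M : Term Δ B} (p : Occ R M) (S : Stack R B C) →
                           redexesBelow p ⊆ redexesAt p S
  redexesBelow⊆redexesAt {M = ƛ M} p S r∈ with ∈-++⁻ (primeAt p []) r∈
  ... | inj₁ r∈prime = primeAt⊆redexesAt p {T = S} [] r∈prime
  redexesBelow⊆redexesAt {M = ƛ M} p []      r∈ | inj₂ r∈body = redexesBelow⊆redexesAt (body p) [] r∈body
  redexesBelow⊆redexesAt {M = ƛ M} p (n ∷ S) r∈ | inj₂ r∈body =
    there (redexesBelow⊆redexesAt (body p) S r∈body)
  redexesBelow⊆redexesAt {M = M · N} p S r∈ with ∈-++⁻ (primeAt p []) r∈
  ... | inj₁ r∈prime = primeAt⊆redexesAt p {T = S} [] r∈prime
  ... | inj₂ r∈rest with ∈-++⁻ (redexesBelow (fun p)) r∈rest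
  ...   | inj₁ r∈fun = ∈-++⁺ˡ (redexesBelow⊆redexesAt (fun p) (arg p ∷ S) r∈fun)
  ...   | inj₂ r∈arg = ∈-++⁺ʳ (redexesAt (fun p) (arg p ∷ S)) (redexesBelow⊆redexesAt (arg p) [] r∈arg)

  primeAt[]⊆redexesBelow : {M : Term Δ B} (p : Occ R M) → primeAt p [] ⊆ redexesBelow p
  primeAt[]⊆redexesBelow {M = ƛ M}   p r∈ = ∈-++⁺ˡ r∈
  primeAt[]⊆redexesBelow {M = M · N} p r∈ = ∈-++⁺ˡ r∈

  -- A redex whose argument comes from `S` is prime for the application to `S` but need not be
  -- listed below `p`, hence the two cases.
  redexesAt⊆ : {M : Term Δ B} (p : Occ R M) (S : Stack R B C) {r : Redex R} →
               r ∈ redexesAt p S → r ∈ primeAt p S ⊎ r ∈ redexesBelow p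
  redexesAt⊆ {M = ƛ M} p [] r∈ with redexesAt⊆ (body p) [] r∈
  ... | inj₁ r∈prime = inj₁ r∈prime
  ... | inj₂ r∈body  = inj₂ (∈-++⁺ʳ (primeAt p []) r∈body)
  redexesAt⊆ {M = ƛ M} p (n ∷ S) (here refl) = inj₁ (here refl)
  redexesAt⊆ {M = ƛ M} p (n ∷ S) (there r∈) with redexesAt⊆ (body p) S r∈
  ... | inj₁ r∈prime = inj₁ (there r∈prime)
  ... | inj₂ r∈body  = inj₂ (∈-++⁺ʳ (primeAt p []) r∈body)
  redexesAt⊆ {M = M · N} p S r∈ with ∈-++⁻ (redexesAt (fun p) (arg p ∷ S)) r∈
  ... | inj₁ r∈fun with redexesAt⊆ (fun p) (arg p ∷ S) r∈fun
  ...   | inj₁ r∈prime = inj₁ r∈prime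
  ...   | inj₂ r∈below = inj₂ (∈-++⁺ʳ (primeAt p []) (∈-++⁺ˡ r∈below))
  redexesAt⊆ {M = M · N} p S r∈ | inj₂ r∈arg =
    inj₂ (∈-++⁺ʳ (primeAt p []) (∈-++⁺ʳ (redexesBelow (fun p))
      ([ primeAt[]⊆redexesBelow (arg p) , id ]′ (redexesAt⊆ (arg p) [] r∈arg))))

  -- Addresses list the deepest step first, so descendants of `a` have `a` as a suffix.
  BinderBelow : List ℕ → Redex R → Set
  BinderBelow a r = ∃ λ u → binderAddress r ≡ u ++ a

  below-tail : ∀ {i a rs} → All (BinderBelow (i ∷ a)) rs → All (BinderBelow a) rs
  below-tail {i} {a} = All.map λ (u , eq) → u ∷ʳ i , trans eq (sym (++-assoc u [ i ] a))

  redexesAt-below : {M : Term Δ B} (p : Occ R M) (S : Stack R B C) →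
                    All (BinderBelow (address p)) (redexesAt p S)
  redexesAt-below {M = con}   p S       = []
  redexesAt-below {M = var x} p S       = []
  redexesAt-below {M = ƛ M}   p []      = below-tail (redexesAt-below (body p) [])
  redexesAt-below {M = ƛ M}   p (n ∷ S) = ([] , refl) ∷ below-tail (redexesAt-below (body p) S)
  redexesAt-below {M = M · N} p S       =
    All.++⁺ (below-tail (redexesAt-below (fun p) (arg p ∷ S)))
            (below-tail (redexesAt-below (arg p) []))

  below-irrefl : ∀ {a i} (u : List ℕ) → a ≢ u ++ i ∷ a
  below-irrefl {a} {i} u eq with ++-identityˡ-unique (u ∷ʳ i) (trans eq (sym (++-assoc u [ i ] a)))
  below-irrefl []      eq | ()
  below-irrefl (_ ∷ _) eq | ()

  below-disjoint : ∀ {a} (u v : List ℕ) → u ++ 0 ∷ a ≢ v ++ 1 ∷ a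
  below-disjoint {a} u v eq
    with ∷ʳ-injectiveʳ u v (++-cancelʳ a (u ∷ʳ 0) (v ∷ʳ 1)
           (trans (++-assoc u [ 0 ] a) (trans eq (sym (++-assoc v [ 1 ] a)))))
  ... | ()

  -- Binders alone tell redexes apart: a binder lies strictly above those in its body, and function
  -- and argument part ways at the step 0 or 1 just below the application.
  redexesAt-distinct : {M : Term Δ B} (p : Occ R M) (S : Stack R B C) →
                       AllPairs (λ r s → binderAddress r ≢ binderAddress s) (redexesAt p S)
  redexesAt-distinct {M = con}   p S       = []
  redexesAt-distinct {M = var x} p S       = []
  redexesAt-distinct {M = ƛ M}   p []      = redexesAt-distinct (body p) []
  redexesAt-distinct {M = ƛ M}   p (n ∷ S) =
    All.map (λ (u , eq) p≡ → below-irrefl u (trans p≡ eq)) (redexesAt-below (body p) S)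
    ∷ redexesAt-distinct (body p) S
  redexesAt-distinct {M = M · N} p S       =
    AllPairs.++⁺ (redexesAt-distinct (fun p) (arg p ∷ S)) (redexesAt-distinct (arg p) [])
      (All.map (λ (u , eq) → All.map (λ (v , eq′) r≡s → below-disjoint u v (trans (sym eq) (trans r≡s eq′)))
                                     (redexesAt-below (arg p) []))
               (redexesAt-below (fun p) (arg p ∷ S)))

  redexesAt⊆genRedexes : redexesAt {M = R} root [] ⊆ genRedexes R
  redexesAt⊆genRedexes r∈ =
    [ primeAt[]⊆redexesBelow root , id ]′ (redexesAt⊆ root [] r∈)

  genRedexes⊆redexesAt : genRedexes R ⊆ redexesAt {M = R} root []
  genRedexes⊆redexesAt = redexesBelow⊆redexesAt root []

-- Two repetition-free lists with the same elements: neither is longer than the other.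
#redexes≡count : (M : Term Γ A) → #redexes M ≡ count M 0
#redexes≡count M = ℕ.≤-antisym
  (begin
    length (deduplicate _≟_ gen) ≤⟨ length-⊆ (deduplicate-! _≟_ gen) dedup⊆all ⟩
    length all                   ≡⟨ length-all ⟩
    count M 0                    ∎)
  (begin
    count M 0                    ≡⟨ length-all ⟨
    length all                   ≤⟨ length-⊆ unique all⊆dedup ⟩
    length (deduplicate _≟_ gen) ∎)
  where
  open ℕ.≤-Reasoning
  _≟_ = ×-≡-dec (≡-dec ℕ._≟_) (≡-dec ℕ._≟_)
  gen = map addresses (genRedexes M)
  all = map addresses (redexesAt {M = M} root [])
  length-all : length all ≡ count M 0
  length-all = trans (length-map addresses (redexesAt {M = M} root [])) (length-redexesAt {M = M} root [])
  map⊆ : ∀ {rs ss : List (Redex M)} → rs ⊆ ss → map addresses rs ⊆ map addresses ss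
  map⊆ sub r∈ with ∈-map⁻ addresses r∈
  ... | r , r∈rs , refl = ∈-map⁺ addresses (sub r∈rs)
  dedup⊆all : deduplicate _≟_ gen ⊆ all
  dedup⊆all r∈ = map⊆ genRedexes⊆redexesAt (∈-deduplicate⁻ _≟_ gen r∈)
  all⊆dedup : all ⊆ deduplicate _≟_ gen
  all⊆dedup r∈ = ∈-deduplicate⁺ _≟_ (map⊆ redexesAt⊆genRedexes r∈)
  unique : Unique all
  unique = AllPairs.map⁺ (AllPairs.map (λ r≢s eq → r≢s (cong proj₁ eq)) (redexesAt-distinct {M = M} root []))

-- η-long terms

-- The type of M M₁ … Mₖ for M : A; the value o is junk if A takes fewer than
-- k arguments.
resultTy : Ty → ℕ → Ty
resultTy A       zero    = A
resultTy (A ⇒ B) (suc k) = resultTy B k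
resultTy o       (suc k) = o

arity : Ty → ℕ
arity o       = 0
arity (A ⇒ B) = suc (arity B)

-- η-longness in a form that descends to subterms: a term in function position is judged together
-- with its `k` arguments.
LongAt : Term Γ A → ℕ → Set
LongAt M k = ∀ {M′} → M →η M′ → count M k < count M′ k

ηLong⇒LongAt : {M : Term Γ A} → ηLong M → LongAt M 0
ηLong⇒LongAt {M = M} long {M′} η = begin-strict
  count M 0   ≡⟨ #redexes≡count M ⟨
  #redexes M  <⟨ long η ⟩
  #redexes M′ ≡⟨ #redexes≡count M′ ⟩
  count M′ 0  ∎
  where open ℕ.≤-Reasoning

LongAt-ƛ-zero : {M : Term (A ∷ Γ) B} → LongAt (ƛ M) 0 → LongAt M 0
LongAt-ƛ-zero long η = long (lam η)

LongAt-ƛ-suc : {M : Term (A ∷ Γ) B} → LongAt (ƛ M) (suc k) → LongAt M k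
LongAt-ƛ-suc long η = s<s⁻¹ (long (lam η))

LongAt-fun : {M : Term Γ (A ⇒ B)} {N : Term Γ A} → LongAt (M · N) k → LongAt M (suc k)
LongAt-fun {N = N} long η = ℕ.+-cancelʳ-< (count N 0) _ _ (long (appˡ η))

LongAt-arg : {M : Term Γ (A ⇒ B)} {N : Term Γ A} → LongAt (M · N) k → LongAt N 0
LongAt-arg {k = k} {M = M} long η = ℕ.+-cancelˡ-< (count M (suc k)) _ _ (long (appʳ η))

-- The outermost expansion adds an abstraction without argument, so any redex it creates comes from
-- `M` consuming the new variable.
LongAt⇒count-suc : (M : Term Γ (A ⇒ B)) → LongAt M 0 → count M 0 < count M 1
LongAt⇒count-suc M long = begin-strict
  count M 0          <⟨ long exp ⟩
  count (wk M) 1 + 0 ≡⟨ ℕ.+-identityʳ _ ⟩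
  count (wk M) 1     ≡⟨ count-rename there M ⟩
  count M 1          ∎
  where open ℕ.≤-Reasoning

LongAt⇒result : (M : Term Γ A) → LongAt M 0 → A ≡ o ⊎ count M 0 < count M 1
LongAt⇒result {A = o}     M long = inj₁ refl
LongAt⇒result {A = _ ⇒ _} M long = inj₂ (LongAt⇒count-suc M long)

-- Fits ℓ M k S: among the arguments M₁ … Mₖ of M followed by those
-- interpreted by S, the latter are all consumed by abstractions over
-- variables of level less than ℓ before the head of M is reached. A constant
-- head is exempt, as its arguments are not interpreted.
Fits : ℕ → Term Γ A → ℕ → List Skeleton → Set
Fits ℓ con             k       S       = ⊤
Fits ℓ (var x)         k       S       = S ≡ []
Fits ℓ (ƛ M)           zero    []      = ⊤
Fits ℓ (ƛ {A} M)       zero    (a ∷ S) = lv A < ℓ × Fits ℓ M 0 S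
Fits ℓ (ƛ M)           (suc k) S       = Fits ℓ M k S
Fits ℓ (M · N)         k       S       = Fits ℓ M (suc k) S

Fits-[] : ∀ {ℓ} (M : Term Γ A) k → Fits ℓ M k []
Fits-[] con     k       = tt
Fits-[] (var x) k       = refl
Fits-[] (ƛ M)   zero    = tt
Fits-[] (ƛ M)   (suc k) = Fits-[] M k
Fits-[] (M · N) k       = Fits-[] M (suc k)

-- The second hypothesis says that a (k+1)-st argument of M would be consumed
-- by an abstraction.
LongAt⇒Fits : ∀ {ℓ} (M : Term Γ A) {k} {S} → LongAt M k →
              resultTy A k ≡ o ⊎ count M k < count M (suc k) →
              length S ≡ arity (resultTy A k) → lv (resultTy A k) ≤ ℓ → Fits ℓ M k S
LongAt⇒Fits con long res len lv≤ = tt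
LongAt⇒Fits (var x) {S = []}    long res       len lv≤ = refl
-- A variable gains no redex from a further argument, so only result type `o` remains, and it admits
-- no arguments.
LongAt⇒Fits (var x) {S = _ ∷ _} long (inj₁ eq) len lv≤ with () ← trans len (cong arity eq)
LongAt⇒Fits (ƛ M) {zero} {[]}    long res len lv≤ = tt
-- Whether the body consumes the next argument is decided afresh, by its own η-longness.
LongAt⇒Fits (ƛ {A} {B} M) {zero} {a ∷ S} long res len lv≤ =
  ℕ.≤-trans (ℕ.m≤m⊔n _ (lv B)) lv≤ ,
  LongAt⇒Fits M (LongAt-ƛ-zero long) (LongAt⇒result M (LongAt-ƛ-zero long)) (ℕ.suc-injective len)
              (ℕ.≤-trans (ℕ.m≤n⊔m (suc (lv A)) _) lv≤)
LongAt⇒Fits (ƛ M) {suc k} long (inj₁ eq) len lv≤ = LongAt⇒Fits M (LongAt-ƛ-suc long) (inj₁ eq) len lv≤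
LongAt⇒Fits (ƛ M) {suc k} long (inj₂ lt) len lv≤ = LongAt⇒Fits M (LongAt-ƛ-suc long) (inj₂ (s<s⁻¹ lt)) len lv≤
LongAt⇒Fits (M · N) {k} long (inj₁ eq) len lv≤ =
  LongAt⇒Fits M (LongAt-fun {k = k} {N = N} long) (inj₁ eq) len lv≤
LongAt⇒Fits (M · N) {k} long (inj₂ lt) len lv≤ =
  LongAt⇒Fits M (LongAt-fun {k = k} {N = N} long) (inj₂ (ℕ.+-cancelʳ-< (count N 0) _ _ lt)) len lv≤

-- Locally scoped terms

module _ {R : Term Γ A} where

  -- The number of arguments of the subterm at p in R, including those that are
  -- not adjacent to it, such as P for M in (λx.M) N P.
  pending : {M : Term Δ B} → Occ R M → ℕ
  pending root     = 0
  pending (body p) = pred (pending p)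
  pending (fun p)  = suc (pending p)
  pending (arg p)  = 0

  redexesAt-pending : {M : Term Δ B} (p : Occ R M) (S : Stack R B C) → stackLength S ≡ pending p →
                      All (λ r → 0 < pending (Redex.binder r)) (redexesAt p S)
  redexesAt-pending {M = con}   p S       eq = []
  redexesAt-pending {M = var x} p S       eq = []
  redexesAt-pending {M = ƛ M}   p []      eq = redexesAt-pending (body p) [] (cong pred eq)
  redexesAt-pending {M = ƛ M}   p (n ∷ S) eq =
    subst (0 <_) eq z<s ∷ redexesAt-pending (body p) S (cong pred eq)
  redexesAt-pending {M = M · N} p S       eq =
    All.++⁺ (redexesAt-pending (fun p) (arg p ∷ S) (cong suc eq)) (redexesAt-pending (arg p) [] refl)

  Bound⇒0<pending : Var R B → Set
  Bound⇒0<pending (free x)  = ⊤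
  Bound⇒0<pending (bound p) = 0 < pending p

  -- Used contrapositively: an abstraction that lacks an argument in `R` binds an inactive variable.
  active-pending : {v : Var R B} → Active R v → Bound⇒0<pending v
  active-pending (free x∈)  = tt
  active-pending (redex r∈) =
    lookup (redexesAt-pending {M = R} root [] refl) (genRedexes⊆redexesAt r∈)

  AllActive : {N : Term Δ B} → Occ R N → Set
  AllActive {Δ} {N = N} n = ∀ {C} (y : C ∈ Δ) → y ∈FV N → Active R (name n y)

-- Interpretation

⟦⟧-cong-FV : (M : Term Γ A) {S : List Skeleton} {ρ ρ′ : BSEnv Γ} →
             (∀ {B} (x : B ∈ Γ) → x ∈FV M → lookup ρ x ≡ lookup ρ′ x) →
             ⟦ M ∣ S ⟧ ρ ≡ ⟦ M ∣ S ⟧ ρ′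
⟦⟧-cong-FV con     agree = refl
⟦⟧-cong-FV (var x) agree rewrite agree x var = refl
⟦⟧-cong-FV (ƛ M) {[]}    agree = ⟦⟧-cong-FV M λ where
  (here refl) x∈ → refl
  (there x)   x∈ → agree x (lam x∈)
⟦⟧-cong-FV (ƛ M) {a ∷ S} agree = ⟦⟧-cong-FV M λ where
  (here refl) x∈ → refl
  (there x)   x∈ → agree x (lam x∈)
⟦⟧-cong-FV (M · N) {S} {ρ} {ρ′} agree = trans
  (cong (λ a → ⟦ M ∣ a ∷ S ⟧ ρ) (⟦⟧-cong-FV N λ x x∈ → agree x (appʳ x∈)))
  (⟦⟧-cong-FV M λ x x∈ → agree x (appˡ x∈))

⟦rename⟧ : (ι : Γ ⊆ Δ) (M : Term Γ A) {S : List Skeleton} {ρ : BSEnv Γ} {ρ′ : BSEnv Δ} →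
           (∀ {B} (x : B ∈ Γ) → lookup ρ′ (ι x) ≡ lookup ρ x) →
           ⟦ rename ι M ∣ S ⟧ ρ′ ≡ ⟦ M ∣ S ⟧ ρ
⟦rename⟧ ι con     agree = refl
⟦rename⟧ ι (var x) agree rewrite agree x = refl
⟦rename⟧ ι (ƛ M) {[]}    agree = ⟦rename⟧ (lift ι) M λ where
  (here refl) → refl
  (there x)   → agree x
⟦rename⟧ ι (ƛ M) {a ∷ S} agree = ⟦rename⟧ (lift ι) M λ where
  (here refl) → refl
  (there x)   → agree x
⟦rename⟧ ι (M · N) {S} {ρ} {ρ′} agree = trans
  (cong (λ a → ⟦ rename ι M ∣ a ∷ S ⟧ ρ′) (⟦rename⟧ ι N agree))
  (⟦rename⟧ ι M agree)

⟦wk⟧ : (M : Term Γ A) {S : List Skeleton} {ρ : BSEnv Γ} {b : Maybe Skeleton} →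
       ⟦ wk {B = B} M ∣ S ⟧ (b ∷ ρ) ≡ ⟦ M ∣ S ⟧ ρ
⟦wk⟧ M = ⟦rename⟧ there M λ x → refl

-- Skeletons

-- Only roots are compared. Shared children must be identical, as passing arguments leaves
-- everything deeper unchanged; `E` describes the children allowed in excess.
_≼[_]_ : Skeleton → (ℕ × Skeleton → Set) → Skeleton → Set
a ≼[ E ] b = label a ≤ label b × (∀ {c} → c ∈ children a → c ∈ children b ⊎ E c)

≼-⨆ : ∀ {E as bs} → Pointwise _≼[ E ]_ as bs → ⨆ as ≼[ E ] ⨆ bs
≼-⨆ [] = z≤n , λ ()
≼-⨆ {E} {a ∷ as} {b ∷ bs} ((a≤b , children-a) ∷ as≼bs) with ≼-⨆ as≼bs
... | ⨆as≤⨆bs , children-as = ℕ.⊔-mono-≤ a≤b ⨆as≤⨆bs , λ c∈ → split (∈-++⁻ (children a) c∈)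
  where
  split : ∀ {c} → c ∈ children a ⊎ c ∈ concatMap children as → c ∈ children b ++ concatMap children bs ⊎ E c
  split (inj₁ c∈a) with children-a c∈a
  ... | inj₁ c∈b = inj₁ (∈-++⁺ˡ c∈b)
  ... | inj₂ e   = inj₂ e
  split (inj₂ c∈as) with children-as c∈as
  ... | inj₁ c∈bs = inj₁ (∈-++⁺ʳ (children b) c∈bs)
  ... | inj₂ e    = inj₂ e

≼-1+ : ∀ {E} a b → a ≼[ E ] b → (1+ a) ≼[ E ] (1+ b)
≼-1+ (node m as) (node n bs) (m≤n , as⊆) = s≤s m≤n , as⊆

≼-·[] : ∀ {E} a b {d c} → a ≼[ E ] b → (a ·[ d ] c) ≼[ E ] (b ·[ d ] c)
≼-·[] {E} (node m as) (node n bs) {d} {c} (m≤n , as⊆) = m≤n , λ e∈ → split (∈-++⁻ as e∈)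
  where
  split : ∀ {e} → e ∈ as ⊎ e ∈ [ (d , c) ] → e ∈ bs ++ [ (d , c) ] ⊎ E e
  split (inj₁ e∈as) with as⊆ e∈as
  ... | inj₁ e∈bs = inj₁ (∈-++⁺ˡ e∈bs)
  ... | inj₂ ex   = inj₂ ex
  split (inj₂ e∈c) = inj₁ (∈-++⁺ʳ bs e∈c)

≼-·[]ˡ : ∀ {E} a b {d c} → E (d , c) → a ≼[ E ] b → (a ·[ d ] c) ≼[ E ] b
≼-·[]ˡ {E} (node m as) b {d} {c} ex (m≤n , as⊆) = m≤n , λ e∈ → split (∈-++⁻ as e∈)
  where
  split : ∀ {e} → e ∈ as ⊎ e ∈ [ (d , c) ] → e ∈ children b ⊎ E e
  split (inj₁ e∈as)        = as⊆ e∈as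
  split (inj₂ (here refl)) = inj₂ ex

-- Passing arguments to N only adds them as children, on edges labeled by at
-- most the level of N.
Conservative : Term Γ A → Set
Conservative {Γ} {A} N =
  ∀ (ρ : BSEnv Γ) S → length S ≡ arity A →
  ⟦ N ∣ S ⟧ ρ ≼[ (λ (d , a) → d ≤ lv A × a ∈ S) ] ⟦ N ⟧ ρ

-- Interpreting a subterm with and without extra arguments

module Compare {R : Term Γ A} (scoped : LocallyScoped R) (ℓ : ℕ) (S₀ : List Skeleton) where

  Passed : ℕ × Skeleton → Set
  Passed (d , a) = d ≤ ℓ × a ∈ S₀

  _≼_ : Skeleton → Skeleton → Set
  _≼_ = _≼[ Passed ]_

  -- `ρ` arises with the extra arguments, `ρ′` without. They may differ only at inactive variables.
  Agree : {M : Term Δ B} → Occ R M → BSEnv Δ → BSEnv Δ → Set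
  Agree {Δ} p ρ ρ′ = ∀ {C} (x : C ∈ Δ) →
    lookup ρ x ≡ lookup ρ′ x ⊎
    (¬ Active R (name p x) × lookup ρ′ x ≡ nothing × ∃ λ a → lookup ρ x ≡ just a × Passed (suc (lv C) , a))

  -- For an argument of the head variable a comparison of roots suffices, as `⨆` merges roots. One
  -- stored in the environment needs equal values, available once its free variables are active.
  data Agreeˢ : Stack R B C → List Skeleton → List Skeleton → Set where
    []  : Agreeˢ {B = B} [] [] []
    _∷_ : ∀ {N : Term Δ B} {n : Occ R N} {T : Stack R C D} {a b as bs} →
          (a ≼ b × (AllActive n → a ≡ b)) → Agreeˢ T as bs → Agreeˢ (n ∷ T) (a ∷ as) (b ∷ bs)

  Agreeˢ⇒Pointwise : {T : Stack R B C} {as bs : List Skeleton} → Agreeˢ T as bs → Pointwise _≼_ as bs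
  Agreeˢ⇒Pointwise []             = []
  Agreeˢ⇒Pointwise ((a≼b , _) ∷ T) = a≼b ∷ Agreeˢ⇒Pointwise T

  compare : (M : Term Δ B) (p : Occ R M) (T : Stack R B C) {as bs : List Skeleton} (S : List Skeleton)
            {ρ ρ′ : BSEnv Δ} →
            redexesAt p T ⊆ genRedexes R → stackLength T ≡ pending p →
            Agree p ρ ρ′ → Agreeˢ T as bs → Fits ℓ M (stackLength T) S → S ⊆ S₀ →
            ⟦ M ∣ as ++ S ⟧ ρ ≼ ⟦ M ∣ bs ⟧ ρ′
  compare con p T S red pend agree args fits S⊆ = z≤n , λ ()
  -- `Fits` leaves no extra argument at a variable head: all of them have been bound in `ρ`.
  compare (var x) p T {as} {bs} .[] {ρ} {ρ′} red pend agree args refl S⊆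
    rewrite ++-identityʳ as with agree x
  ... | inj₁ eq rewrite eq with lookup ρ′ x
  ...   | nothing = ≼-1+ (⨆ as) (⨆ bs) (≼-⨆ (Agreeˢ⇒Pointwise args))
  ...   | just a  = ≼-·[] (1+ ⨆ as) (1+ ⨆ bs) (≼-1+ (⨆ as) (⨆ bs) (≼-⨆ (Agreeˢ⇒Pointwise args)))
  compare (var x) p T {as} {bs} .[] {ρ} {ρ′} red pend agree args refl S⊆
      | inj₂ (_ , undef , a , def , passed) rewrite undef | def =
    ≼-·[]ˡ (1+ ⨆ as) (1+ ⨆ bs) passed (≼-1+ (⨆ as) (⨆ bs) (≼-⨆ (Agreeˢ⇒Pointwise args)))
  compare (ƛ M) p [] [] red pend agree [] fits S⊆ =
    compare M (body p) [] [] red (cong pred pend)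
      (λ { (here refl) → inj₁ refl ; (there x) → agree x }) [] (Fits-[] M 0) S⊆
  -- An extra argument is consumed where no argument of `R` is pending, so the bound variable is
  -- inactive.
  compare (ƛ M) p [] (a ∷ S) red pend agree [] (lv< , fits) S⊆ =
    compare M (body p) [] S red (cong pred pend)
      (λ { (here refl) → inj₂ (inactive , refl , a , refl , lv< , S⊆ (here refl)) ; (there x) → agree x })
      [] fits (λ a∈ → S⊆ (there a∈))
    where
    inactive : ¬ Active R (bound p)
    inactive active = ℕ.<-irrefl pend (active-pending active)
  -- A genuine redex of `R`: local scoping makes the free variables of its argument active, so both
  -- sides bind the same value.
  compare (ƛ M) p (n ∷ T) S red pend agree ((_ , eq) ∷ args) fits S⊆
    with refl ← eq (scoped (red (here refl))) =
    compare M (body p) T S (λ r∈ → red (there r∈)) (cong pred pend)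
      (λ { (here refl) → inj₁ refl ; (there x) → agree x }) args fits S⊆
  compare (M · N) p T {as} {bs} S {ρ} {ρ′} red pend agree args fits S⊆ =
    compare M (fun p) (arg p ∷ T) S (λ r∈ → red (∈-++⁺ˡ r∈)) (cong suc pend) agree
      ((N≼ , N≡) ∷ args) fits S⊆
    where
    N≼ : ⟦ N ⟧ ρ ≼ ⟦ N ⟧ ρ′
    N≼ = compare N (arg p) [] [] (λ r∈ → red (∈-++⁺ʳ (redexesAt (fun p) (arg p ∷ T)) r∈)) refl agree []
           (Fits-[] N 0) (λ ())
    N≡ : AllActive (arg p) → ⟦ N ⟧ ρ ≡ ⟦ N ⟧ ρ′
    N≡ active = ⟦⟧-cong-FV N λ x x∈ → [ id , (λ (¬act , _) → ⊥-elim (¬act (active x x∈))) ]′ (agree x)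

conservative : {R : Term Γ A} {N : Term Δ B} → LocallyScoped R → (p : Occ R N) →
               redexesAt p [] ⊆ genRedexes R → pending p ≡ 0 → LongAt N 0 → Conservative N
conservative {B = B} {N = N} scoped p red pend long ρ S len =
  compare N p [] S red (sym pend) (λ x → inj₁ refl) []
          (LongAt⇒Fits N long (LongAt⇒result N long) len ℕ.≤-refl) id
  where open Compare scoped (lv B) S

-- These arguments are all that a head step can take from the term itself. The condition passes from
-- `(ƛ M · N) ·* Ms` to the body applied to the remaining arguments.
ConservativeArgs : Term Γ A → Set
ConservativeArgs con     = ⊤
ConservativeArgs (var x) = ⊤
ConservativeArgs (ƛ M)   = ConservativeArgs M
ConservativeArgs (M · N) = ConservativeArgs M × Conservative N

conservativeArgs : {R : Term Γ A} → LocallyScoped R → (M : Term Δ B) (p : Occ R M) (T : Stack R B C) →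
                   redexesAt p T ⊆ genRedexes R → LongAt M (stackLength T) → ConservativeArgs M
conservativeArgs scoped con     p T       red long = tt
conservativeArgs scoped (var x) p T       red long = tt
conservativeArgs scoped (ƛ M)   p []      red long =
  conservativeArgs scoped M (body p) [] red (LongAt-ƛ-zero long)
conservativeArgs scoped (ƛ M)   p (n ∷ T) red long =
  conservativeArgs scoped M (body p) T (λ r∈ → red (there r∈)) (LongAt-ƛ-suc long)
conservativeArgs scoped (M · N) p T       red long =
  conservativeArgs scoped M (fun p) (arg p ∷ T) (λ r∈ → red (∈-++⁺ˡ r∈)) (LongAt-fun {N = N} long) ,
  conservative scoped (arg p) (λ r∈ → red (∈-++⁺ʳ (redexesAt (fun p) (arg p ∷ T)) r∈)) refl
               (LongAt-arg {k = stackLength T} {M = M} long)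

ηLong⇒ConservativeArgs : {M : Term Γ A} → ηLong M → LocallyScoped M → ConservativeArgs M
ηLong⇒ConservativeArgs {M = M} long scoped =
  conservativeArgs scoped M root [] redexesAt⊆genRedexes (ηLong⇒LongAt long)

ηLong⇒Conservative : {M : Term Γ A} → ηLong M → LocallyScoped M → Conservative M
ηLong⇒Conservative long scoped = conservative scoped root redexesAt⊆genRedexes refl (ηLong⇒LongAt long)

Conservative-wk : {N : Term Γ A} → Conservative N → Conservative (wk {B = B} N)
Conservative-wk {N = N} cons (b ∷ ρ) S len =
  subst₂ (λ a c → a ≼[ _ ] c) (sym (⟦wk⟧ N)) (sym (⟦wk⟧ N)) (cons ρ S len)

-- Head steps

↪-refl : ∀ a → a ↪ a
↪-refl* : ∀ {bs} as → (∀ {c} → c ∈ as → c ∈ bs) →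
          All (λ (d , a) → Any (λ (d′ , a′) → d ≤ d′ × a ↪ a′) bs) as
↪-refl (node n as) = embed ℕ.≤-refl (↪-refl* as λ c∈ → c∈)
↪-refl* []             sub = []
↪-refl* ((d , a) ∷ as) sub = lose (sub (here refl)) (ℕ.≤-refl , ↪-refl a) ∷ ↪-refl* as λ c∈ → sub (there c∈)

-- `n` and `as` are general so that the induction can pass to the tail of `S`, whose join is
-- smaller.
∈⇒↪ : ∀ {n as a S} → a ∈ S → label (⨆ S) ≤ n → (∀ {c} → c ∈ children (⨆ S) → c ∈ as) → a ↪ node n as
∈⇒↪ {a = node m bs} (here refl) ≤n ⊆as =
  embed (ℕ.≤-trans (ℕ.m≤m⊔n m _) ≤n) (↪-refl* bs λ c∈ → ⊆as (∈-++⁺ˡ c∈))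
∈⇒↪ {S = s ∷ S} (there a∈) ≤n ⊆as =
  ∈⇒↪ a∈ (ℕ.≤-trans (ℕ.m≤n⊔m (label s) _) ≤n) (λ c∈ → ⊆as (∈-++⁺ʳ (children s) c∈))

-- Reducing the child N of the root of x M₁ … Mₙ leaves the Mᵢ below the edge
-- labeled lv x, which is where Conservative puts them.
head-step : (ρ : BSEnv Γ) (x : A ∈ Γ) {S : List Skeleton} {b c : Skeleton} → lookup ρ x ≡ just b →
            c ≼[ (λ (d , a) → d ≤ lv A × a ∈ S) ] b →
            ∃ λ a → ⟦ var x ∣ S ⟧ ρ ⇝ a × c ↪ a
head-step {A = A} ρ x {S} {node n bs} {node m cs} eq (m≤n , cs⊆) rewrite eq =
  -- The last child, on edge `suc (lv A)`, is the value of `x`. The step moves to it and hangs the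
  -- old tree, root label lowered by one, below an edge `lv A`.
  _ , step (∈-++⁺ʳ (concatMap children S) (here refl)) , embed m≤n (All.tabulate child)
  where
  rest : Skeleton
  rest = ⨆ S ·[ suc (lv A) ] node n bs
  child : ∀ {c} → c ∈ cs → Any (λ (d′ , a′) → proj₁ c ≤ d′ × proj₂ c ↪ a′) (bs ++ [ (lv A , rest) ])
  child {d , a} c∈ with cs⊆ c∈
  ... | inj₁ c∈bs       = lose (∈-++⁺ˡ c∈bs) (ℕ.≤-refl , ↪-refl a)
  ... | inj₂ (d≤ , a∈S) = lose (∈-++⁺ʳ bs (here refl)) (d≤ , ∈⇒↪ a∈S ℕ.≤-refl ∈-++⁺ˡ)

-- Reduction in an environment

⟦_⟧* : Args Γ A B → BSEnv Γ → List Skeleton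
⟦ [] ⟧*     ρ = []
⟦ N ∷ Ns ⟧* ρ = ⟦ N ⟧ ρ ∷ ⟦ Ns ⟧* ρ

⟦·*⟧ : (M : Term Γ A) (Ms : Args Γ A B) {ρ : BSEnv Γ} → ⟦ M ·* Ms ⟧ ρ ≡ ⟦ M ∣ ⟦ Ms ⟧* ρ ⟧ ρ
⟦·*⟧ M []       = refl
⟦·*⟧ M (N ∷ Ms) = ⟦·*⟧ (M · N) Ms

⟦wkArgs⟧ : (Ms : Args Γ A B) {ρ : BSEnv Γ} {b : Maybe Skeleton} →
           ⟦ wkArgs {C = C} Ms ⟧* (b ∷ ρ) ≡ ⟦ Ms ⟧* ρ
⟦wkArgs⟧ []       = refl
⟦wkArgs⟧ (N ∷ Ms) = cong₂ _∷_ (⟦wk⟧ N) (⟦wkArgs⟧ Ms)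

-- Result type `o` forces full application, as `Conservative` requires.
length-⟦⟧* : (Ms : Args Γ A o) {ρ : BSEnv Γ} → length (⟦ Ms ⟧* ρ) ≡ arity A
length-⟦⟧* []       = refl
length-⟦⟧* (N ∷ Ms) = cong suc (length-⟦⟧* Ms)

AllConservative : Args Γ A B → Set
AllConservative []       = ⊤
AllConservative (N ∷ Ns) = Conservative N × AllConservative Ns

AllConservative-wk : (Ms : Args Γ A B) → AllConservative Ms → AllConservative (wkArgs {C = C} Ms)
AllConservative-wk []       tt         = tt
AllConservative-wk (N ∷ Ms) (cN , cMs) = Conservative-wk {N = N} cN , AllConservative-wk Ms cMs

ConservativeArgs-·*⁺ : (M : Term Γ A) (Ms : Args Γ A B) →
                       ConservativeArgs M → AllConservative Ms → ConservativeArgs (M ·* Ms)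
ConservativeArgs-·*⁺ M []       cM tt         = cM
ConservativeArgs-·*⁺ M (N ∷ Ms) cM (cN , cMs) = ConservativeArgs-·*⁺ (M · N) Ms (cM , cN) cMs

ConservativeArgs-·*⁻ : (M : Term Γ A) (Ms : Args Γ A B) →
                       ConservativeArgs (M ·* Ms) → ConservativeArgs M × AllConservative Ms
ConservativeArgs-·*⁻ M []       cM = cM , tt
ConservativeArgs-·*⁻ M (N ∷ Ms) c with ConservativeArgs-·*⁻ (M · N) Ms c
... | (cM , cN) , cMs = cM , cN , cMs

lookup-⟦⟧ᴱ-just : (σ : All (λ A → Maybe (Closure Γ A)) Δ) (x : A ∈ Δ) {N : Term Γ A} {τ : Env Γ} →
                  lookup σ x ≡ just ⟨ N , τ ⟩ → lookup ⟦ σ ⟧ᴱ x ≡ just (⟦ N ⟧ ⟦ τ ⟧ᴱ)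
lookup-⟦⟧ᴱ-just (just ⟨ N , τ ⟩ ∷ σ) (here refl) refl = refl
lookup-⟦⟧ᴱ-just (nothing ∷ σ)        (here refl) ()
lookup-⟦⟧ᴱ-just (nothing ∷ σ)        (there x)   eq   = lookup-⟦⟧ᴱ-just σ x eq
lookup-⟦⟧ᴱ-just (just ⟨ _ , _ ⟩ ∷ σ) (there x)   eq   = lookup-⟦⟧ᴱ-just σ x eq

lookup-⟦⟧ᴱ-nothing : (σ : All (λ A → Maybe (Closure Γ A)) Δ) (x : A ∈ Δ) →
                     lookup σ x ≡ nothing → lookup ⟦ σ ⟧ᴱ x ≡ nothing
lookup-⟦⟧ᴱ-nothing (nothing ∷ σ)        (here refl) eq = refl
lookup-⟦⟧ᴱ-nothing (nothing ∷ σ)        (there x)   eq = lookup-⟦⟧ᴱ-nothing σ x eq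
lookup-⟦⟧ᴱ-nothing (just ⟨ _ , _ ⟩ ∷ σ) (here refl) ()
lookup-⟦⟧ᴱ-nothing (just ⟨ _ , _ ⟩ ∷ σ) (there x)   eq = lookup-⟦⟧ᴱ-nothing σ x eq

⟦wkClosures⟧ : (σ : All (λ A → Maybe (Closure Γ A)) Δ) → ⟦ wkClosures {B = B} σ ⟧ᴱ ≡ ⟦ σ ⟧ᴱ
⟦wkClosures⟧ []                   = refl
⟦wkClosures⟧ (nothing ∷ σ)        = cong (nothing ∷_) (⟦wkClosures⟧ σ)
⟦wkClosures⟧ (just ⟨ N , τ ⟩ ∷ σ) =
  cong₂ (λ a ρ → just a ∷ ρ) (trans (⟦wk⟧ N) (cong ⟦ N ⟧ (⟦wkClosures⟧ τ))) (⟦wkClosures⟧ σ)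

lookup-wkClosures : (σ : All (λ A → Maybe (Closure Γ A)) Δ) (x : A ∈ Δ) {c : Closure (B ∷ Γ) A} →
                    lookup (wkClosures σ) x ≡ just c → ∃ λ c′ → lookup σ x ≡ just c′ × c ≡ wkClosure c′
lookup-wkClosures (just c ∷ σ)  (here refl) refl = c , refl , refl
lookup-wkClosures (nothing ∷ σ) (here refl) ()
lookup-wkClosures (nothing ∷ σ) (there x)   eq   = lookup-wkClosures σ x eq
lookup-wkClosures (just c ∷ σ)  (there x)   eq   = lookup-wkClosures σ x eq

-- The equation lets a stored term be read in `σ` itself, and it survives extension by a closure
-- over `σ`.
ConservativeEnv : Env Γ → Set
ConservativeEnv {Γ} σ = ∀ {A} (x : A ∈ Γ) {N τ} → lookup σ x ≡ just ⟨ N , τ ⟩ →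
                        Conservative N × ⟦ N ⟧ ⟦ τ ⟧ᴱ ≡ ⟦ N ⟧ ⟦ σ ⟧ᴱ

-- Among the free variables of `N`, flatness handles those defined in `τ` and `KeepsUndefined` the
-- others.
flat⇒ConservativeEnv : (σ : Env Γ) → ηLongᴱ σ → LocallyScopedᴱ σ → Flat σ → KeepsUndefined σ →
                       ConservativeEnv σ
flat⇒ConservativeEnv {Γ} σ (hereditarily long) (hereditarily scoped) flat undef x {N} {τ} eq =
  ηLong⇒Conservative (proj₁ (long x eq)) (proj₁ (scoped x eq)) , ⟦⟧-cong-FV N agree
  where
  agree : ∀ {B} (y : B ∈ Γ) → y ∈FV N → lookup ⟦ τ ⟧ᴱ y ≡ lookup ⟦ σ ⟧ᴱ y
  agree y y∈ with lookup τ y in eq-y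
  ... | nothing        =
    trans (lookup-⟦⟧ᴱ-nothing τ y eq-y) (sym (lookup-⟦⟧ᴱ-nothing σ y (undef x eq y y∈ eq-y)))
  ... | just ⟨ P , υ ⟩ =
    trans (lookup-⟦⟧ᴱ-just τ y eq-y) (sym (lookup-⟦⟧ᴱ-just σ y (flat x eq y eq-y)))

ConservativeEnv-∪↦ : {σ : Env Γ} {N : Term Γ B} → Conservative N → ConservativeEnv σ →
                     ConservativeEnv (σ ∪↦ N)
ConservativeEnv-∪↦ {σ = σ} {N} cN cσ (here refl) refl =
  Conservative-wk {N = N} cN , trans (⟦wk⟧ N) (sym (⟦wk⟧ N))
ConservativeEnv-∪↦ {σ = σ} {N} cN cσ (there x) eq with lookup-wkClosures σ x eq
... | ⟨ P , τ ⟩ , eq′ , refl with cσ x eq′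
...   | cP , ⟦P⟧≡ = Conservative-wk {N = P} cP , (begin
  ⟦ wk P ⟧ (nothing ∷ ⟦ wkClosures τ ⟧ᴱ) ≡⟨ ⟦wk⟧ P ⟩
  ⟦ P ⟧ ⟦ wkClosures τ ⟧ᴱ                ≡⟨ cong ⟦ P ⟧ (⟦wkClosures⟧ τ) ⟩
  ⟦ P ⟧ ⟦ τ ⟧ᴱ                           ≡⟨ ⟦P⟧≡ ⟩
  ⟦ P ⟧ ⟦ σ ⟧ᴱ                           ≡⟨ cong ⟦ P ⟧ (⟦wkClosures⟧ σ) ⟨
  ⟦ P ⟧ ⟦ wkClosures σ ⟧ᴱ                ≡⟨ ⟦wk⟧ P ⟨
  ⟦ wk P ⟧ ⟦ σ ∪↦ N ⟧ᴱ                   ∎)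
  where open ≡-Reasoning

Simulates : Skeleton → Skeleton → Set
Simulates a b = ∃[ c ] (a ⇝ c × b ↪ c)

⟦β⟧ : (M : Term (A ∷ Γ) B) (N : Term Γ A) (Ms : Args Γ B C) (σ : Env Γ) →
      ⟦ (ƛ M · N) ·* Ms ⟧ ⟦ σ ⟧ᴱ ≡ ⟦ M ·* wkArgs Ms ⟧ ⟦ σ ∪↦ N ⟧ᴱ
⟦β⟧ M N Ms σ = sym (begin
  ⟦ M ·* wkArgs Ms ⟧ ⟦ σ ∪↦ N ⟧ᴱ           ≡⟨ cong ⟦ M ·* wkArgs Ms ⟧ ⟦σ∪↦N⟧ ⟩
  ⟦ M ·* wkArgs Ms ⟧ ρ+N                   ≡⟨ ⟦·*⟧ M (wkArgs Ms) ⟩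
  ⟦ M ∣ ⟦ wkArgs Ms ⟧* ρ+N ⟧ ρ+N           ≡⟨ cong (λ S → ⟦ M ∣ S ⟧ ρ+N) (⟦wkArgs⟧ Ms) ⟩
  ⟦ M ∣ ⟦ Ms ⟧* ρ ⟧ ρ+N                    ≡⟨ ⟦·*⟧ (ƛ M · N) Ms ⟨
  ⟦ (ƛ M · N) ·* Ms ⟧ ρ                    ∎)
  where
  open ≡-Reasoning
  ρ = ⟦ σ ⟧ᴱ
  ρ+N = just (⟦ N ⟧ ρ) ∷ ρ
  ⟦σ∪↦N⟧ : ⟦ σ ∪↦ N ⟧ᴱ ≡ ρ+N
  ⟦σ∪↦N⟧ = cong₂ (λ a ρ → just a ∷ ρ) (trans (⟦wk⟧ N) (cong ⟦ N ⟧ (⟦wkClosures⟧ σ))) (⟦wkClosures⟧ σ)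

-- By `⟦β⟧`, entering a redex leaves the interpretation unchanged, so the real work is at the head.
-- `abs` cannot occur at type `o`.
⟶-simulated : {σ : Env Γ} {M M′ : Term Γ o} → ConservativeArgs M → ConservativeEnv σ →
              M ⟶[ σ ] M′ → Simulates (⟦ M ⟧ ⟦ σ ⟧ᴱ) (⟦ M′ ⟧ ⟦ σ ⟧ᴱ)
⟶-simulated {σ = σ} cM cσ (head {N = N} {x = x} Ms eq)
  rewrite ⟦·*⟧ (var x) Ms {⟦ σ ⟧ᴱ} | ⟦·*⟧ N Ms {⟦ σ ⟧ᴱ} with cσ x eq
... | cN , ⟦N⟧≡ =
  head-step ⟦ σ ⟧ᴱ x (trans (lookup-⟦⟧ᴱ-just σ x eq) (cong just ⟦N⟧≡)) (cN ⟦ σ ⟧ᴱ _ (length-⟦⟧* Ms))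
⟶-simulated {σ = σ} cM cσ (beta {M′ = M′} {M″} {M₁} Ms red)
  with ConservativeArgs-·*⁻ (ƛ M′ · M₁) Ms cM
... | (cM′ , cM₁) , cMs =
  subst₂ Simulates (sym (⟦β⟧ M′ M₁ Ms σ)) (sym (⟦β⟧ M″ M₁ Ms σ))
    (⟶-simulated (ConservativeArgs-·*⁺ M′ (wkArgs Ms) cM′ (AllConservative-wk Ms cMs))
                 (ConservativeEnv-∪↦ {σ = σ} {N = M₁} cM₁ cσ) red)

-- Linear head reduction

module At {R : Term Γ A} (ρ₀ : BSEnv Γ) where

  -- The arguments and the environment in which the subterm at an occurrence
  -- is reached when R is interpreted in ρ₀.
  stackAt : {M : Term Δ B} → Occ R M → List Skeleton
  envAt   : {M : Term Δ B} → Occ R M → BSEnv Δ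
  stackAt root            = []
  stackAt (body p)        = drop 1 (stackAt p)
  stackAt (fun {N = N} p) = ⟦ N ⟧ (envAt p) ∷ stackAt p
  stackAt (arg p)         = []
  envAt root     = ρ₀
  envAt (body p) = List.head (stackAt p) ∷ envAt p
  envAt (fun p)  = envAt p
  envAt (arg p)  = envAt p

  value : Var R B → Maybe Skeleton
  value (free x)  = lookup ρ₀ x
  value (bound p) = List.head (stackAt p)

  -- Values depend on names alone, which makes environments at different occurrences comparable.
  lookup-envAt : {M : Term Δ B} (p : Occ R M) (x : C ∈ Δ) → lookup (envAt p) x ≡ value (name p x)
  lookup-envAt root     x           = refl
  lookup-envAt (body p) (here refl) = refl
  lookup-envAt (body p) (there x)   = lookup-envAt p x
  lookup-envAt (fun p)  x           = lookup-envAt p x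
  lookup-envAt (arg p)  x           = lookup-envAt p x

  -- Interpretation descends the leftmost path and reaches `p` with the same stack and environment,
  -- whatever term stands there.
  ⟦replace⟧ : {M : Term Δ B} {p : Occ R M} → Leftmost p → (L : Term Δ B) →
              ⟦ replace p L ⟧ ρ₀ ≡ ⟦ L ∣ stackAt p ⟧ (envAt p)
  ⟦replace⟧ root L = refl
  ⟦replace⟧ (body {p = p} left) L with stackAt p | ⟦replace⟧ left (ƛ L)
  ... | []    | eq = eq
  ... | a ∷ S | eq = eq
  ⟦replace⟧ (fun {N = N} left) L = ⟦replace⟧ left (L · N)

  length-stackAt : {M : Term Δ B} {p : Occ R M} → A ≡ o → Leftmost p → length (stackAt p) ≡ arity B
  length-stackAt refl root = refl
  length-stackAt A≡o (body {p = p} left) =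
    trans (length-drop 1 (stackAt p)) (cong pred (length-stackAt A≡o left))
  length-stackAt A≡o (fun left) = cong suc (length-stackAt A≡o left)

  data StackAt : Stack R B C → List Skeleton → Set where
    []  : StackAt {B = B} [] []
    _∷_ : ∀ {N : Term Δ B} {n : Occ R N} {T : Stack R C D} {S} →
          Conservative N → StackAt T S → StackAt (n ∷ T) (⟦ N ⟧ (envAt n) ∷ S)

  ArgumentValue : Redex R → Set
  ArgumentValue (redex {N = N} b n) = Conservative N × value (bound b) ≡ just (⟦ N ⟧ (envAt n))

  -- `primeAt` and the interpretation push and pop arguments in step, so a binder receives the value
  -- of its partner. `S` is a separate index because `stackAt p` cannot be matched on.
  primeAt-value : {M : Term Δ B} (p : Occ R M) (T : Stack R B C) → ConservativeArgs M →
                  ∀ {S} → stackAt p ≡ S → StackAt T S →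
                  All ArgumentValue (primeAt p T)
  primeAt-value {M = con}   p T       cM        eq T≈        = []
  primeAt-value {M = var x} p T       cM        eq T≈        = []
  primeAt-value {M = ƛ M}   p []      cM        eq []        =
    primeAt-value (body p) [] cM (cong (drop 1) eq) []
  primeAt-value {M = ƛ M}   p (n ∷ T) cM        eq (cN ∷ T≈) =
    (cN , cong List.head eq) ∷ primeAt-value (body p) T cM (cong (drop 1) eq) T≈
  primeAt-value {M = M · N} p T       (cM , cN) eq T≈        =
    primeAt-value (fun p) (arg p ∷ T) cM (cong (_ ∷_) eq) (cN ∷ T≈)

  primeRedexes-value : ConservativeArgs R → All ArgumentValue (primeRedexes R)
  primeRedexes-value cR = primeAt-value root [] cR refl []

replace-self : {R : Term Γ A} {M : Term Δ B} (p : Occ R M) → replace p M ≡ R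
replace-self root     = refl
replace-self (body p) = replace-self p
replace-self (fun p)  = replace-self p
replace-self (arg p)  = replace-self p

lhr-simulated : {M M′ : Term Γ o} (ρ₀ : BSEnv Γ) → ConservativeArgs M → M →lhr M′ →
                Simulates (⟦ M ⟧ ρ₀) (⟦ M′ ⟧ ρ₀)
lhr-simulated {M = M} ρ₀ cM (lhr {N = N} {x = x} x₀ λx n left r∈ x≡ ι ι≡)
  with lookup (At.primeRedexes-value {R = M} ρ₀ cM) r∈
... | cN , value≡ =
  subst₂ Simulates
    (trans (sym (⟦replace⟧ left (var x))) (cong (λ L → ⟦ L ⟧ ρ₀) (replace-self x₀)))
    -- `ι` preserves names, so the copy of `N` at `x₀` is interpreted as `N` in the environment of
    -- its original place.
    (trans (sym (⟦rename⟧ ι N same-value)) (sym (⟦replace⟧ left (rename ι N))))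
    (head-step (envAt x₀) x (trans (lookup-envAt x₀ x) (trans (cong value x≡) value≡))
               (cN (envAt n) (stackAt x₀) (length-stackAt refl left)))
  where
  open At {R = M} ρ₀
  same-value : ∀ {D} (y : D ∈ _) → lookup (envAt x₀) (ι y) ≡ lookup (envAt n) y
  same-value y = trans (lookup-envAt x₀ (ι y)) (trans (cong value (ι≡ y)) (sym (lookup-envAt n y)))

proposition5p31 : ∀ {Γ} {M M′ : Term Γ o} →
    ηLong M → LocallyScoped M → ηLong M′ → LocallyScoped M′ →
    ((σ : Env Γ) → ηLongᴱ σ → LocallyScopedᴱ σ → Flat σ → KeepsUndefined σ →
    M ⟶[ σ ] M′ →
    ∃[ a ] (⟦ M ⟧ ⟦ σ ⟧ᴱ ⇝ a × ⟦ M′ ⟧ ⟦ σ ⟧ᴱ ↪ a))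
    × (M →lhr M′ →
    ∃[ a ] (⟦ M ⟧ ∅ᴮ ⇝ a × ⟦ M′ ⟧ ∅ᴮ ↪ a))
proposition5p31 long scoped long′ scoped′ =
  (λ σ longσ scopedσ flat undef → ⟶-simulated cM (flat⇒ConservativeEnv σ longσ scopedσ flat undef)) ,
  lhr-simulated ∅ᴮ cM
  where cM = ηLong⇒ConservativeArgs long scoped
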